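{- Let $n\ge 1$, let $\mathcal{P}=([n],\preceq)$ be a naturally labeled poset and let $s=(s_1,\ldots,s_n)$ be a sequence of positive integers. Let $k\in\mathbb{Z}_{>0}$ and let $\lambda\in kO(\mathcal{P},s)\cap\mathbb{Z}^n$. Then there are unique elements $\lambda^{(1)},\ldots,\lambda^{(k)}\in O(\mathcal{P},s)\cap\mathbb{Z}^n$ such that $$\lambda^{(1)}\unlhd\lambda^{(2)}\unlhd\cdots\unlhd\lambda^{(k)}\quad\text{and}\quad \lambda=\lambda^{(1)}+\lambda^{(2)}+\cdots+\lambda^{(k)}.$$ Moreover, if $\lambda=\gamma^{(1)}+\gamma^{(2)}+\cdots+\gamma^{(m)}$ where $m\le k$ and $\gamma^{(1)},\ldots,\gamma^{(m)}\in O(\mathcal{P},s)\cap\mathbb{Z}^n$, then $\lambda^{(1)}(x)\le\gamma^{(i)}(x)\le\lambda^{(k)}(x)$ for all $x\in[n]$ and all $i\in[m]$.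
   Context: Write $[n]=\{1,\ldots,n\}$. A poset $\mathcal{P}=([n],\preceq)$ is naturally labeled if $i\le j$ (as integers) whenever $i\preceq j$. Points $p\in\mathbb{R}^n$ are identified with maps $p:[n]\to\mathbb{R}$, and $p_i$ and $p(i)$ both denote the $i$-th coordinate. The $s$-lecture hall order polytope is $$O(\mathcal{P},s)=\left\{\lambda\in\mathbb{R}^n : \tfrac{\lambda_i}{s_i}\le\tfrac{\lambda_j}{s_j}\text{ whenever } i\prec j,\ \text{ and } 0\le\lambda_i\le s_i\text{ for all } i\in[n]\right\}.$$ For a positive integer $k$, $kO(\mathcal{P},s)=\{kp : p\in O(\mathcal{P},s)\}$. For $\lambda,\gamma\in O(\mathcal{P},s)\cap\mathbb{Z}^n$, write $\lambda\unlhd\gamma$ if (1) $\lambda_i\le\gamma_i$ for all $i\in[n]$, and (2) for every $i\in[n]$, if $\lambda_i\ne 0$ then $\gamma_i=s_i$. -}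

module Defs where

open import Level using (Level; 0ℓ) renaming (suc to lsuc)
open import Data.Nat as ℕ using (ℕ; suc)
open import Data.Integer as ℤ using (ℤ; +_; 0ℤ)
open import Data.Rational as ℚ using (ℚ; 0ℚ; 1ℚ; ∣_∣; 1/_; Positive; NonNegative; positive; nonNegative)
import Data.Rational.Properties as ℚₚ
open import Data.Fin as Fin using (Fin; inject₁)
open import Data.Product using (_×_; _,_; ∃-syntax)
open import Relation.Binary using (Rel; IsPartialOrder)
open import Relation.Binary.PropositionalEquality using (_≡_; _≢_; refl; cong; sym)
open import Relation.Unary using (Pred; _∈_)
import Relation.Binary.Construct.NonStrictToStrict as ToStrict
open import Algebra.Definitions.RawMonoid ℤ.+-0-rawMonoid using (sum)

-- ℝ is the setoid of Cauchy sequences of rationals; its equality is _≈_.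

Cauchy : Pred (ℕ → ℚ) 0ℓ
Cauchy a = ∀ (ε : ℚ) → 0ℚ ℚ.< ε →
  ∃[ N ] (∀ m n → N ℕ.≤ m → N ℕ.≤ n → ∣ a m ℚ.- a n ∣ ℚ.≤ ε)

record ℝ : Set where
  constructor mkℝ
  field
    seq    : ℕ → ℚ
    cauchy : Cauchy seq

open ℝ public

infix 4 _≤ᴿ_ _≈_

_≤ᴿ_ : Rel ℝ 0ℓ
x ≤ᴿ y = ∀ (ε : ℚ) → 0ℚ ℚ.< ε →
  ∃[ N ] (∀ n → N ℕ.≤ n → seq x n ℚ.≤ seq y n ℚ.+ ε)

_≈_ : Rel ℝ 0ℓ
x ≈ y = ∀ (ε : ℚ) → 0ℚ ℚ.< ε →
  ∃[ N ] (∀ n → N ℕ.≤ n → ∣ seq x n ℚ.- seq y n ∣ ℚ.≤ ε)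

fromℚ : ℚ → ℝ
fromℚ q = mkℝ (λ _ → q) λ ε 0<ε → 0 , λ _ _ _ _ →
  ℚₚ.≤-trans (ℚₚ.≤-reflexive (cong ∣_∣ (ℚₚ.+-inverseʳ q))) (ℚₚ.<⇒≤ 0<ε)

fromℤ : ℤ → ℝ
fromℤ z = fromℚ (z ℚ./ 1)

fromℕ : ℕ → ℝ
fromℕ n = fromℤ (+ n)

private
  scale-cauchy : ∀ q a → Cauchy a → Cauchy (λ n → q ℚ.* a n)
  scale-cauchy q a ca ε 0<ε = bound (ca δ (ℚₚ.positive⁻¹ δ))
    where
    instance
      ε-pos : Positive ε
      ε-pos = positive 0<ε
      ∣q∣-nonNeg : NonNegative ∣ q ∣
      ∣q∣-nonNeg = nonNegative (ℚₚ.0≤∣p∣ q)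

    M : ℚ
    M = 1ℚ ℚ.+ ∣ q ∣

    instance
      M-pos : Positive M
      M-pos = ℚₚ.pos+nonNeg⇒pos 1ℚ ∣ q ∣
      M-nonZero : ℚ.NonZero M
      M-nonZero = ℚₚ.pos⇒nonZero M
      1/M-pos : Positive (1/ M)
      1/M-pos = ℚₚ.1/pos⇒pos M

    δ : ℚ
    δ = 1/ M ℚ.* ε

    instance
      δ-pos : Positive δ
      δ-pos = ℚₚ.pos*pos⇒pos (1/ M) ε
      δ-nonNeg : NonNegative δ
      δ-nonNeg = ℚₚ.pos⇒nonNeg δ

    ∣q∣≤M : ∣ q ∣ ℚ.≤ M
    ∣q∣≤M = ℚₚ.≤-trans (ℚₚ.≤-reflexive (sym (ℚₚ.+-identityˡ ∣ q ∣)))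
                       (ℚₚ.+-monoˡ-≤ ∣ q ∣ (ℚₚ.<⇒≤ (ℚₚ.positive⁻¹ 1ℚ)))

    distrib : ∀ b c → q ℚ.* b ℚ.- q ℚ.* c ≡ q ℚ.* (b ℚ.- c)
    distrib b c rewrite ℚₚ.*-distribˡ-+ q b (ℚ.- c) | ℚₚ.neg-distribʳ-* q c = refl

    bound : ∃[ N ] (∀ m n → N ℕ.≤ m → N ℕ.≤ n → ∣ a m ℚ.- a n ∣ ℚ.≤ δ) →
            ∃[ N ] (∀ m n → N ℕ.≤ m → N ℕ.≤ n → ∣ q ℚ.* a m ℚ.- q ℚ.* a n ∣ ℚ.≤ ε)
    bound (N , h) = N , λ m n N≤m N≤n → begin
      ∣ q ℚ.* a m ℚ.- q ℚ.* a n ∣  ≡⟨ cong ∣_∣ (distrib (a m) (a n)) ⟩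
      ∣ q ℚ.* (a m ℚ.- a n) ∣      ≡⟨ ℚₚ.∣p*q∣≡∣p∣*∣q∣ q (a m ℚ.- a n) ⟩
      ∣ q ∣ ℚ.* ∣ a m ℚ.- a n ∣    ≤⟨ ℚₚ.*-monoˡ-≤-nonNeg ∣ q ∣ (h m n N≤m N≤n) ⟩
      ∣ q ∣ ℚ.* δ                  ≤⟨ ℚₚ.*-monoʳ-≤-nonNeg δ ∣q∣≤M ⟩
      M ℚ.* (1/ M ℚ.* ε)           ≡⟨ ℚₚ.*-assoc M (1/ M) ε ⟨
      M ℚ.* 1/ M ℚ.* ε             ≡⟨ cong (ℚ._* ε) (ℚₚ.*-inverseʳ M) ⟩
      1ℚ ℚ.* ε                     ≡⟨ ℚₚ.*-identityˡ ε ⟩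
      ε                            ∎
      where open ℚₚ.≤-Reasoning

infixr 8 _•_
infixl 7 _÷_

_•_ : ℚ → ℝ → ℝ
q • x = mkℝ (λ n → q ℚ.* seq x n) (scale-cauchy q (seq x) (cauchy x))

_÷_ : ℝ → (d : ℕ) → .{{ℕ.NonZero d}} → ℝ
x ÷ d = (+ 1 ℚ./ d) • x

-- The set [n] is represented by Fin n.
record NaturallyLabeledPoset (n : ℕ) (ℓ : Level) : Set (lsuc ℓ) where
  field
    _≼_            : Rel (Fin n) ℓ
    isPartialOrder : IsPartialOrder _≡_ _≼_
    natural        : ∀ {i j} → i ≼ j → i Fin.≤ j

  open ToStrict _≡_ _≼_ public using () renaming (_<_ to _≺_)

module _ {n : ℕ} where

  -- k S = { k p : p ∈ S }, closed under the equality of ℝ.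
  dilate : ∀ {ℓ} → ℕ → Pred (Fin n → ℝ) ℓ → Pred (Fin n → ℝ) ℓ
  dilate k S q = ∃[ p ] (p ∈ S × (∀ i → q i ≈ (+ k ℚ./ 1) • p i))

  -- S ∩ ℤⁿ, as a set of integer vectors.
  latticePoints : ∀ {ℓ} → Pred (Fin n → ℝ) ℓ → Pred (Fin n → ℤ) ℓ
  latticePoints S v = (λ i → fromℤ (v i)) ∈ S

  module _ (s : Fin n → ℕ) where

    O : ∀ {ℓ} → NaturallyLabeledPoset n ℓ → .{{∀ {i} → ℕ.NonZero (s i)}} →
        Pred (Fin n → ℝ) ℓ
    O P p = (∀ i j → i ≺ j → p i ÷ s i ≤ᴿ p j ÷ s j)
          × (∀ i → fromℕ 0 ≤ᴿ p i × p i ≤ᴿ fromℕ (s i))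
      where open NaturallyLabeledPoset P

    infix 4 _⊴_

    _⊴_ : Rel (Fin n → ℤ) 0ℓ
    u ⊴ v = (∀ i → u i ℤ.≤ v i) × (∀ i → u i ≢ 0ℤ → v i ≡ + s i)

  IsSumOf : ∀ {m} → (Fin n → ℤ) → (Fin m → Fin n → ℤ) → Set
  IsSumOf v w = ∀ x → v x ≡ sum (λ i → w i x)

  record IsChainDecomposition {ℓ} (P : NaturallyLabeledPoset n ℓ)
    (s : Fin n → ℕ) .{{_ : ∀ {i} → ℕ.NonZero (s i)}} {k-1 : ℕ}
    (v : Fin n → ℤ) (w : Fin (suc k-1) → Fin n → ℤ) : Set ℓ where
    field
      isLatticePoint : ∀ i → w i ∈ latticePoints (O s P)
      isChain        : ∀ (i : Fin k-1) → _⊴_ s (w (inject₁ i)) (w (Fin.suc i))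
      isSum          : IsSumOf v w

{-# OPTIONS --safe #-}
module Submission where

-- Fix a coordinate x and put a = λ(x), σ = s(x).  Along a ⊴-chain the values at
-- x are 0, …, 0, r, σ, …, σ, so they are determined by their sum: the value that
-- is followed by t others must be min(σ, a ∸ tσ).  These values add up to a
-- because a ≤ kσ.  Divided by σ the formula reads min(1, a/σ ∸ t), which is
-- monotone in a/σ, so the pieces again lie in the order polytope.  In a sum of at
-- most k terms from [0, σ] each term is at least a ∸ (k-1)σ and at most
-- min(σ, a), the first and last values of the chain.

open import Defs
open import Level using (Level)
open import Data.Nat as ℕ using (ℕ; zero; suc; NonZero; _⊓_; _∸_; z≤n; s≤s)
import Data.Nat.Properties as ℕₚ
open import Data.Integer as ℤ using (ℤ; +_; 0ℤ)
import Data.Integer.Properties as ℤₚ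
open import Data.Rational as ℚ using (ℚ; 0ℚ; ½; ∣_∣; 1/_; Positive)
import Data.Rational.Properties as ℚₚ
open import Data.Rational.Unnormalised as ℚᵘ using (mkℚᵘ; *≡*; *≤*)
import Data.Rational.Unnormalised.Properties as ℚᵘₚ
open import Data.Fin as Fin using (Fin; toℕ; inject₁)
import Data.Fin.Properties as Finₚ
open import Data.Product using (_×_; ∃-syntax; _,_; proj₁; proj₂)
open import Data.Sum using (inj₁; inj₂)
open import Function using (_∘_)
open import Relation.Nullary using (yes; no)
open import Relation.Unary using (_∈_)
open import Relation.Binary.PropositionalEquality using (_≡_; _≢_; refl; sym; trans; cong; cong₂; subst; subst₂; module ≡-Reasoning)
open import Algebra.Properties.AbelianGroup ℚₚ.+-0-abelianGroup using (⁻¹-anti-homo‿-; xyx⁻¹≈y)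
open import Algebra.Definitions.RawMonoid ℕ.+-0-rawMonoid using (sum)
open import Algebra.Definitions.RawMonoid ℤ.+-0-rawMonoid using () renaming (sum to sumℤ)

-- Rational arithmetic

p≤∣p∣ : ∀ p → p ℚ.≤ ∣ p ∣
p≤∣p∣ p with ℚₚ.≤-total 0ℚ p
... | inj₁ 0≤p = ℚₚ.≤-reflexive (sym (ℚₚ.0≤p⇒∣p∣≡p 0≤p))
... | inj₂ p≤0 = ℚₚ.≤-trans p≤0 (ℚₚ.0≤∣p∣ p)

p+[q-p]≡q : ∀ p q → p ℚ.+ (q ℚ.- p) ≡ q
p+[q-p]≡q p q = trans (sym (ℚₚ.+-assoc p q (ℚ.- p))) (xyx⁻¹≈y p q)

∣p-q∣≤r⇒p≤q+r : ∀ p q {r} → ∣ p ℚ.- q ∣ ℚ.≤ r → p ℚ.≤ q ℚ.+ r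
∣p-q∣≤r⇒p≤q+r p q {r} h = begin
  p                ≡⟨ p+[q-p]≡q q p ⟨
  q ℚ.+ (p ℚ.- q)  ≤⟨ ℚₚ.+-monoʳ-≤ q (ℚₚ.≤-trans (p≤∣p∣ (p ℚ.- q)) h) ⟩
  q ℚ.+ r          ∎
  where open ℚₚ.≤-Reasoning

∣p-q∣≡∣q-p∣ : ∀ p q → ∣ p ℚ.- q ∣ ≡ ∣ q ℚ.- p ∣
∣p-q∣≡∣q-p∣ p q = trans (sym (ℚₚ.∣-p∣≡∣p∣ (p ℚ.- q))) (cong ∣_∣ (⁻¹-anti-homo‿- p q))

½*p+½*p≡p : ∀ p → ½ ℚ.* p ℚ.+ ½ ℚ.* p ≡ p
½*p+½*p≡p p = trans (sym (ℚₚ.*-distribʳ-+ p ½ ½)) (ℚₚ.*-identityˡ p)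

0<*-pos : ∀ q .{{_ : Positive q}} {ε} → 0ℚ ℚ.< ε → 0ℚ ℚ.< q ℚ.* ε
0<*-pos q {ε} 0<ε = subst (ℚ._< q ℚ.* ε) (ℚₚ.*-zeroʳ q) (ℚₚ.*-monoʳ-<-pos q 0<ε)

-- `_/_` on `ℚ` reduces to lowest terms. Passing to unnormalised fractions recovers the given
-- numerator and denominator, and there the order is cross-multiplication by definition.
toℚᵘ-/ : ∀ a d .{{_ : NonZero d}} → ℚ.toℚᵘ (a ℚ./ d) ℚᵘ.≃ a ℚᵘ./ d
toℚᵘ-/ a (suc d-1) = ℚₚ.toℚᵘ-fromℚᵘ (mkℚᵘ a d-1)

/-mono-≤ : ∀ a d b e .{{_ : NonZero d}} .{{_ : NonZero e}} →
  a ℤ.* + e ℤ.≤ b ℤ.* + d → a ℚ./ d ℚ.≤ b ℚ./ e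
/-mono-≤ a d@(suc _) b e@(suc _) h = ℚₚ.toℚᵘ-cancel-≤
  (ℚᵘₚ.≤-respˡ-≃ (ℚᵘₚ.≃-sym (toℚᵘ-/ a d)) (ℚᵘₚ.≤-respʳ-≃ (ℚᵘₚ.≃-sym (toℚᵘ-/ b e)) (*≤* h)))

/-cancel-≤ : ∀ a d b e .{{_ : NonZero d}} .{{_ : NonZero e}} →
  a ℚ./ d ℚ.≤ b ℚ./ e → a ℤ.* + e ℤ.≤ b ℤ.* + d
/-cancel-≤ a d@(suc _) b e@(suc _) h = ℚᵘₚ.drop-*≤*
  (ℚᵘₚ.≤-respˡ-≃ (toℚᵘ-/ a d) (ℚᵘₚ.≤-respʳ-≃ (toℚᵘ-/ b e) (ℚₚ.toℚᵘ-mono-≤ h)))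

/1-mono-≤ : ∀ {a b} → a ℤ.≤ b → a ℚ./ 1 ℚ.≤ b ℚ./ 1
/1-mono-≤ {a} {b} h = /-mono-≤ a 1 b 1 (ℤₚ.*-monoʳ-≤-nonNeg (+ 1) h)

/1-cancel-≤ : ∀ {a b} → a ℚ./ 1 ℚ.≤ b ℚ./ 1 → a ℤ.≤ b
/1-cancel-≤ {a} {b} h = subst₂ ℤ._≤_ (ℤₚ.*-identityʳ a) (ℤₚ.*-identityʳ b) (/-cancel-≤ a 1 b 1 h)

/-*-/1 : ∀ a d .{{_ : NonZero d}} b → (a ℚ./ d) ℚ.* (b ℚ./ 1) ≡ (a ℤ.* b) ℚ./ d
/-*-/1 a d@(suc d-1) b = ℚₚ.toℚᵘ-injective (begin
  ℚ.toℚᵘ ((a ℚ./ d) ℚ.* (b ℚ./ 1))           ≈⟨ ℚₚ.toℚᵘ-homo-* (a ℚ./ d) (b ℚ./ 1) ⟩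
  ℚ.toℚᵘ (a ℚ./ d) ℚᵘ.* ℚ.toℚᵘ (b ℚ./ 1)     ≈⟨ ℚᵘₚ.*-cong (toℚᵘ-/ a d) (toℚᵘ-/ b 1) ⟩
  (a ℚᵘ./ d) ℚᵘ.* (b ℚᵘ./ 1)                 ≈⟨ *≡* (cong (a ℤ.* b ℤ.*_) (cong +_ (sym (ℕₚ.*-identityʳ d)))) ⟩
  (a ℤ.* b) ℚᵘ./ d                           ≈⟨ toℚᵘ-/ (a ℤ.* b) d ⟨
  ℚ.toℚᵘ ((a ℤ.* b) ℚ./ d)                   ∎)
  where open import Relation.Binary.Reasoning.Setoid ℚᵘₚ.≃-setoid

1/-*-/1 : ∀ d .{{_ : NonZero d}} a → (+ 1 ℚ./ d) ℚ.* (a ℚ./ 1) ≡ a ℚ./ d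
1/-*-/1 d a = trans (/-*-/1 (+ 1) d a) (cong (ℚ._/ d) (ℤₚ.*-identityˡ a))

-- The order on ℝ

pointwise⇒≤ᴿ : ∀ {x y} → (∀ n → seq x n ℚ.≤ seq y n) → x ≤ᴿ y
pointwise⇒≤ᴿ {x} {y} h ε 0<ε = 0 , λ n _ → begin
  seq x n           ≤⟨ h n ⟩
  seq y n           ≡⟨ ℚₚ.+-identityʳ (seq y n) ⟨
  seq y n ℚ.+ 0ℚ    ≤⟨ ℚₚ.+-monoʳ-≤ (seq y n) (ℚₚ.<⇒≤ 0<ε) ⟩
  seq y n ℚ.+ ε     ∎
  where open ℚₚ.≤-Reasoning

-- Were `q < p`, a rational `r` strictly between them would give the tolerance `r - q`, at which the
-- hypothesis reads `p ≤ r`, contradicting `r < p`. Every return from `ℝ` to the integers rests on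
-- this.
fromℚ-cancel-≤ : ∀ {p q} → fromℚ p ≤ᴿ fromℚ q → p ℚ.≤ q
fromℚ-cancel-≤ {p} {q} h = ℚₚ.≮⇒≥ λ q<p →
  let (r , q<r , r<p) = ℚₚ.<-dense q<p
      0<r-q           = subst (ℚ._< r ℚ.- q) (ℚₚ.+-inverseʳ q) (ℚₚ.+-monoˡ-< (ℚ.- q) q<r)
      (N , p≤q+[r-q]) = h (r ℚ.- q) 0<r-q
      p≤r             = subst (p ℚ.≤_) (p+[q-p]≡q q r) (p≤q+[r-q] N ℕₚ.≤-refl)
  in ℚₚ.<-irrefl refl (ℚₚ.<-≤-trans r<p p≤r)

≤ᴿ-trans : ∀ {x y z} → x ≤ᴿ y → y ≤ᴿ z → x ≤ᴿ z
≤ᴿ-trans {x} {y} {z} x≤y y≤z ε 0<ε =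
  let δ       = ½ ℚ.* ε
      0<δ     = 0<*-pos ½ 0<ε
      (M , f) = x≤y δ 0<δ
      (N , g) = y≤z δ 0<δ
  in M ℕ.⊔ N , λ n M⊔N≤n → begin
    seq x n                ≤⟨ f n (ℕₚ.m⊔n≤o⇒m≤o M N M⊔N≤n) ⟩
    seq y n ℚ.+ δ          ≤⟨ ℚₚ.+-monoˡ-≤ δ (g n (ℕₚ.m⊔n≤o⇒n≤o M N M⊔N≤n)) ⟩
    seq z n ℚ.+ δ ℚ.+ δ    ≡⟨ ℚₚ.+-assoc (seq z n) δ δ ⟩
    seq z n ℚ.+ (δ ℚ.+ δ)  ≡⟨ cong (seq z n ℚ.+_) (½*p+½*p≡p ε) ⟩
    seq z n ℚ.+ ε          ∎
  where open ℚₚ.≤-Reasoning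

≈⇒≤ᴿ : ∀ {x y} → x ≈ y → x ≤ᴿ y
≈⇒≤ᴿ {x} {y} x≈y ε 0<ε = let (N , h) = x≈y ε 0<ε in
  N , λ n N≤n → ∣p-q∣≤r⇒p≤q+r (seq x n) (seq y n) (h n N≤n)

≈-sym : ∀ {x y} → x ≈ y → y ≈ x
≈-sym {x} {y} x≈y ε 0<ε = let (N , h) = x≈y ε 0<ε in
  N , λ n N≤n → subst (ℚ._≤ ε) (∣p-q∣≡∣q-p∣ (seq x n) (seq y n)) (h n N≤n)

•-mono-≤ᴿ : ∀ q .{{_ : Positive q}} {x y} → x ≤ᴿ y → q • x ≤ᴿ q • y
•-mono-≤ᴿ q {x} {y} x≤y ε 0<ε =
  -- Scaling by `q` turns the tolerance `1/ q * ε` into `ε`.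
  let (N , h) = x≤y (1/ q ℚ.* ε) (0<*-pos (1/ q) 0<ε)
  in N , λ n N≤n → begin
    q ℚ.* seq x n                             ≤⟨ ℚₚ.*-monoˡ-≤-nonNeg q (h n N≤n) ⟩
    q ℚ.* (seq y n ℚ.+ 1/ q ℚ.* ε)            ≡⟨ ℚₚ.*-distribˡ-+ q (seq y n) (1/ q ℚ.* ε) ⟩
    q ℚ.* seq y n ℚ.+ q ℚ.* (1/ q ℚ.* ε)      ≡⟨ cong (q ℚ.* seq y n ℚ.+_) (begin-equality
      q ℚ.* (1/ q ℚ.* ε)  ≡⟨ ℚₚ.*-assoc q (1/ q) ε ⟨
      q ℚ.* 1/ q ℚ.* ε    ≡⟨ cong (ℚ._* ε) (ℚₚ.*-inverseʳ q) ⟩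
      ℚ.1ℚ ℚ.* ε          ≡⟨ ℚₚ.*-identityˡ ε ⟩
      ε                   ∎) ⟩
    q ℚ.* seq y n ℚ.+ ε                       ∎
  where
  open ℚₚ.≤-Reasoning
  instance
    _ = ℚₚ.pos⇒nonZero q
    _ = ℚₚ.pos⇒nonNeg q
    _ = ℚₚ.1/pos⇒pos q

-- Lets `dilate-mono` exchange division by `s i` with the dilation factor.
•-comm-≤ᴿ : ∀ p q x → p • q • x ≤ᴿ q • p • x
•-comm-≤ᴿ p q x = pointwise⇒≤ᴿ {p • q • x} {q • p • x} λ n → ℚₚ.≤-reflexive (begin
  p ℚ.* (q ℚ.* seq x n)  ≡⟨ ℚₚ.*-assoc p q (seq x n) ⟨
  p ℚ.* q ℚ.* seq x n    ≡⟨ cong (ℚ._* seq x n) (ℚₚ.*-comm p q) ⟩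
  q ℚ.* p ℚ.* seq x n    ≡⟨ ℚₚ.*-assoc q p (seq x n) ⟩
  q ℚ.* (p ℚ.* seq x n)  ∎)
  where open ≡-Reasoning

fromℤ-mono-≤ : ∀ {a b} → a ℤ.≤ b → fromℤ a ≤ᴿ fromℤ b
fromℤ-mono-≤ {a} {b} a≤b = pointwise⇒≤ᴿ {fromℤ a} {fromℤ b} λ _ → /1-mono-≤ a≤b

fromℤ-cancel-≤ : ∀ {a b} → fromℤ a ≤ᴿ fromℤ b → a ℤ.≤ b
fromℤ-cancel-≤ h = /1-cancel-≤ (fromℚ-cancel-≤ h)

fromℤ-÷-mono-≤ : ∀ a d b e .{{_ : NonZero d}} .{{_ : NonZero e}} →
  a ℤ.* + e ℤ.≤ b ℤ.* + d → fromℤ a ÷ d ≤ᴿ fromℤ b ÷ e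
fromℤ-÷-mono-≤ a d b e h = pointwise⇒≤ᴿ {fromℤ a ÷ d} {fromℤ b ÷ e} λ _ →
  subst₂ ℚ._≤_ (sym (1/-*-/1 d a)) (sym (1/-*-/1 e b)) (/-mono-≤ a d b e h)

fromℤ-÷-cancel-≤ : ∀ a d b e .{{_ : NonZero d}} .{{_ : NonZero e}} →
  fromℤ a ÷ d ≤ᴿ fromℤ b ÷ e → a ℤ.* + e ℤ.≤ b ℤ.* + d
fromℤ-÷-cancel-≤ a d b e h =
  /-cancel-≤ a d b e (subst₂ ℚ._≤_ (1/-*-/1 d a) (1/-*-/1 e b) (fromℚ-cancel-≤ h))

-- Lattice points of the polytope and its dilates

module _ {ℓ n} (P : NaturallyLabeledPoset n ℓ) (s : Fin n → ℕ) .{{_ : ∀ {i} → NonZero (s i)}} where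

  open NaturallyLabeledPoset P using (_≺_)

  latticePoint⁺ : (a : Fin n → ℕ) → (∀ i j → i ≺ j → a i ℕ.* s j ℕ.≤ a j ℕ.* s i) →
    (∀ i → a i ℕ.≤ s i) → (λ i → + a i) ∈ latticePoints (O s P)
  latticePoint⁺ a mono bound =
    (λ i j i≺j → fromℤ-÷-mono-≤ (+ a i) (s i) (+ a j) (s j)
      (subst₂ ℤ._≤_ (ℤₚ.pos-* (a i) (s j)) (ℤₚ.pos-* (a j) (s i)) (ℤ.+≤+ (mono i j i≺j)))) ,
    λ i → fromℤ-mono-≤ {0ℤ} {+ a i} (ℤ.+≤+ z≤n) , fromℤ-mono-≤ {+ a i} {+ s i} (ℤ.+≤+ (bound i))

  latticePoint-bounds : ∀ {u} → u ∈ latticePoints (O s P) → ∀ i → 0ℤ ℤ.≤ u i × u i ℤ.≤ + s i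
  latticePoint-bounds (_ , bounds) i =
    fromℤ-cancel-≤ (proj₁ (bounds i)) , fromℤ-cancel-≤ (proj₂ (bounds i))

  module _ {k : ℕ} .{{_ : NonZero k}} {v : Fin n → ℤ} (v∈kO : v ∈ latticePoints (dilate k (O s P))) where

    private
      κ : ℚ
      κ = + k ℚ./ 1

      instance
        κ-pos : Positive κ
        κ-pos = ℚₚ.normalize-pos k 1

      p : Fin n → ℝ
      p = proj₁ v∈kO

      p∈O : p ∈ O s P
      p∈O = proj₁ (proj₂ v∈kO)

      v≤κp : ∀ i → fromℤ (v i) ≤ᴿ κ • p i
      v≤κp i = ≈⇒≤ᴿ {fromℤ (v i)} {κ • p i} (proj₂ (proj₂ v∈kO) i)

      κp≤v : ∀ i → κ • p i ≤ᴿ fromℤ (v i)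
      κp≤v i = ≈⇒≤ᴿ {κ • p i} {fromℤ (v i)}
        (≈-sym {fromℤ (v i)} {κ • p i} (proj₂ (proj₂ v∈kO) i))

    -- The coordinates of the witness `p` are arbitrary Cauchy sequences, tied to `v` only by `≈`.
    -- Here and in the next two lemmas the inequality therefore passes through `κ • p`, and is
    -- cancelled only once both ends are constant sequences.
    dilate-lower : ∀ i → 0ℤ ℤ.≤ v i
    dilate-lower i = subst (ℤ._≤ v i) (ℤₚ.*-zeroʳ (+ k))
      (/1-cancel-≤ (subst (ℚ._≤ _) (/-*-/1 (+ k) 1 0ℤ) (fromℚ-cancel-≤
        (≤ᴿ-trans {κ • fromℕ 0} {κ • p i} {fromℤ (v i)}
          (•-mono-≤ᴿ κ {fromℕ 0} {p i} (proj₁ (proj₂ p∈O i))) (κp≤v i)))))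

    dilate-upper : ∀ i → v i ℤ.≤ + (k ℕ.* s i)
    dilate-upper i = subst (v i ℤ.≤_) (sym (ℤₚ.pos-* k (s i)))
      (/1-cancel-≤ (subst (_ ℚ.≤_) (/-*-/1 (+ k) 1 (+ s i)) (fromℚ-cancel-≤
        (≤ᴿ-trans {fromℤ (v i)} {κ • p i} {κ • fromℕ (s i)}
          (v≤κp i) (•-mono-≤ᴿ κ {p i} {fromℕ (s i)} (proj₂ (proj₂ p∈O i)))))))

    dilate-mono : ∀ i j → i ≺ j → v i ℤ.* + s j ℤ.≤ v j ℤ.* + s i
    dilate-mono i j i≺j = fromℤ-÷-cancel-≤ (v i) (s i) (v j) (s j)
      -- The chain is `v i / s i ≤ (κ p i) / s i ≤ κ (p i / s i) ≤ κ (p j / s j) ≤ (κ p j) / s j ≤ v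
      -- j / s j`; the middle link is the order condition on `p`.
      (≤ᴿ-trans {vi} {κ • (p i ÷ s i)} {vj}
        (≤ᴿ-trans {vi} {(κ • p i) ÷ s i} {κ • (p i ÷ s i)}
          (÷-mono-≤ᴿ (s i) {fromℤ (v i)} {κ • p i} (v≤κp i))
          (•-comm-≤ᴿ (+ 1 ℚ./ s i) κ (p i)))
        (≤ᴿ-trans {κ • (p i ÷ s i)} {κ • (p j ÷ s j)} {vj}
          (•-mono-≤ᴿ κ {p i ÷ s i} {p j ÷ s j} (proj₁ p∈O i j i≺j))
          (≤ᴿ-trans {κ • (p j ÷ s j)} {(κ • p j) ÷ s j} {vj}
            (•-comm-≤ᴿ κ (+ 1 ℚ./ s j) (p j))
            (÷-mono-≤ᴿ (s j) {κ • p j} {fromℤ (v j)} (κp≤v j)))))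
      where
      vi vj : ℝ
      vi = fromℤ (v i) ÷ s i
      vj = fromℤ (v j) ÷ s j

      ÷-mono-≤ᴿ : ∀ d .{{_ : NonZero d}} {x y} → x ≤ᴿ y → x ÷ d ≤ᴿ y ÷ d
      ÷-mono-≤ᴿ d {x} {y} = •-mono-≤ᴿ (+ 1 ℚ./ d) {{ℚₚ.normalize-pos 1 d}} {x} {y}

-- Sums of bounded sequences of naturals

sumℤ-+ : ∀ {m} (f : Fin m → ℤ) (g : Fin m → ℕ) → (∀ i → f i ≡ + g i) → sumℤ f ≡ + sum g
sumℤ-+ {zero}  f g f≡g = refl
sumℤ-+ {suc m} f g f≡g = cong₂ ℤ._+_ (f≡g Fin.zero) (sumℤ-+ (f ∘ Fin.suc) (g ∘ Fin.suc) (f≡g ∘ Fin.suc))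

sum-≤ : ∀ {m σ} (f : Fin m → ℕ) → (∀ i → f i ℕ.≤ σ) → sum f ℕ.≤ m ℕ.* σ
sum-≤ {zero}  f f≤σ = z≤n
sum-≤ {suc m} f f≤σ = ℕₚ.+-mono-≤ (f≤σ Fin.zero) (sum-≤ (f ∘ Fin.suc) (f≤σ ∘ Fin.suc))

sum-const : ∀ {m σ} (f : Fin m → ℕ) → (∀ i → f i ≡ σ) → sum f ≡ m ℕ.* σ
sum-const {zero}  f f≡σ = refl
sum-const {suc m} f f≡σ = cong₂ ℕ._+_ (f≡σ Fin.zero) (sum-const (f ∘ Fin.suc) (f≡σ ∘ Fin.suc))

term≤sum : ∀ {m} (f : Fin m → ℕ) i → f i ℕ.≤ sum f
term≤sum f Fin.zero    = ℕₚ.m≤m+n (f Fin.zero) _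
term≤sum f (Fin.suc i) = ℕₚ.≤-trans (term≤sum (f ∘ Fin.suc) i) (ℕₚ.m≤n+m _ (f Fin.zero))

-- Every term except the chosen one is replaced by `σ`. This gives the lower bound in the extremal
-- claim.
sum≤others+term : ∀ {m σ} (f : Fin (suc m) → ℕ) → (∀ i → f i ℕ.≤ σ) →
  ∀ i → sum f ℕ.≤ m ℕ.* σ ℕ.+ f i
sum≤others+term {m} {σ} f f≤σ Fin.zero =
  ℕₚ.≤-trans (ℕₚ.+-monoʳ-≤ (f Fin.zero) (sum-≤ (f ∘ Fin.suc) (f≤σ ∘ Fin.suc)))
             (ℕₚ.≤-reflexive (ℕₚ.+-comm (f Fin.zero) (m ℕ.* σ)))
sum≤others+term {suc m} {σ} f f≤σ (Fin.suc i) =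
  ℕₚ.≤-trans (ℕₚ.+-mono-≤ (f≤σ Fin.zero) (sum≤others+term (f ∘ Fin.suc) (f≤σ ∘ Fin.suc) i))
             (ℕₚ.≤-reflexive (sym (ℕₚ.+-assoc σ (m ℕ.* σ) _)))

-- Saturating chains in one coordinate

-- The length of the overlap of the intervals `[0, a]` and `[tσ, (t+1)σ]`. The lemmas below are
-- statements about filling consecutive blocks of length `σ`.
piece : ℕ → ℕ → ℕ → ℕ
piece σ a t = σ ⊓ (a ∸ t ℕ.* σ)

-- After clearing denominators both minima have the same cap `σ * τ` and subtract the same
-- `t * σ * τ`, so only `a * τ` and `b * σ` are left to compare.
piece-mono : ∀ σ a τ b t → a ℕ.* τ ℕ.≤ b ℕ.* σ → piece σ a t ℕ.* τ ℕ.≤ piece τ b t ℕ.* σ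
piece-mono σ a τ b t aτ≤bσ = begin
  (σ ⊓ (a ∸ t ℕ.* σ)) ℕ.* τ               ≡⟨ ℕₚ.*-distribʳ-⊓ τ σ _ ⟩
  (σ ℕ.* τ) ⊓ ((a ∸ t ℕ.* σ) ℕ.* τ)       ≡⟨ cong ((σ ℕ.* τ) ⊓_) (ℕₚ.*-distribʳ-∸ τ a (t ℕ.* σ)) ⟩
  (σ ℕ.* τ) ⊓ (a ℕ.* τ ∸ t ℕ.* σ ℕ.* τ)   ≤⟨ ℕₚ.⊓-monoʳ-≤ (σ ℕ.* τ) (ℕₚ.∸-monoˡ-≤ (t ℕ.* σ ℕ.* τ) aτ≤bσ) ⟩
  (σ ℕ.* τ) ⊓ (b ℕ.* σ ∸ t ℕ.* σ ℕ.* τ)   ≡⟨ cong₂ (λ x y → x ⊓ (b ℕ.* σ ∸ y)) (ℕₚ.*-comm σ τ) tστ≡tτσ ⟩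
  (τ ℕ.* σ) ⊓ (b ℕ.* σ ∸ t ℕ.* τ ℕ.* σ)   ≡⟨ cong ((τ ℕ.* σ) ⊓_) (ℕₚ.*-distribʳ-∸ σ b (t ℕ.* τ)) ⟨
  (τ ℕ.* σ) ⊓ ((b ∸ t ℕ.* τ) ℕ.* σ)       ≡⟨ ℕₚ.*-distribʳ-⊓ σ τ _ ⟨
  (τ ⊓ (b ∸ t ℕ.* τ)) ℕ.* σ               ∎
  where
  open ℕₚ.≤-Reasoning
  tστ≡tτσ : t ℕ.* σ ℕ.* τ ≡ t ℕ.* τ ℕ.* σ
  tστ≡tτσ = trans (ℕₚ.*-assoc t σ τ) (trans (cong (t ℕ.*_) (ℕₚ.*-comm σ τ)) (sym (ℕₚ.*-assoc t τ σ)))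

piece-antitone : ∀ σ a t → piece σ a (suc t) ℕ.≤ piece σ a t
piece-antitone σ a t = ℕₚ.⊓-monoʳ-≤ σ (ℕₚ.∸-monoʳ-≤ a (ℕₚ.m≤n+m (t ℕ.* σ) σ))

piece-full : ∀ σ {a} t → suc t ℕ.* σ ℕ.≤ a → piece σ a t ≡ σ
piece-full σ t h = ℕₚ.m≤n⇒m⊓n≡m (ℕₚ.m+n≤o⇒m≤o∸n σ h)

-- If `[0, a]` reaches into block `t + 1`, it covers block `t`.
piece-saturates : ∀ σ a t → piece σ a (suc t) ≢ 0 → piece σ a t ≡ σ
piece-saturates σ a t ≢0 = piece-full σ t (ℕₚ.<⇒≤ (ℕₚ.m∸n≢0⇒n<m λ ≡0 →
  ≢0 (trans (cong (σ ⊓_) ≡0) (ℕₚ.⊓-zeroʳ σ))))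

-- Cutting `[0, σ + m]` at `m` splits its overlap with `[0, a]` into two lengths. This is the
-- induction step of `sum-pieces`.
⊓-∸-split : ∀ σ a m → σ ⊓ (a ∸ m) ℕ.+ m ⊓ a ≡ (σ ℕ.+ m) ⊓ a
⊓-∸-split σ a m with ℕₚ.≤-total m a
... | inj₁ m≤a = begin
  σ ⊓ (a ∸ m) ℕ.+ m ⊓ a         ≡⟨ cong (σ ⊓ (a ∸ m) ℕ.+_) (ℕₚ.m≤n⇒m⊓n≡m m≤a) ⟩
  σ ⊓ (a ∸ m) ℕ.+ m             ≡⟨ ℕₚ.+-distribʳ-⊓ m σ (a ∸ m) ⟩
  (σ ℕ.+ m) ⊓ (a ∸ m ℕ.+ m)     ≡⟨ cong ((σ ℕ.+ m) ⊓_) (ℕₚ.m∸n+n≡m m≤a) ⟩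
  (σ ℕ.+ m) ⊓ a                 ∎
  where open ≡-Reasoning
... | inj₂ a≤m = begin
  σ ⊓ (a ∸ m) ℕ.+ m ⊓ a         ≡⟨ cong (λ x → σ ⊓ x ℕ.+ m ⊓ a) (ℕₚ.m≤n⇒m∸n≡0 a≤m) ⟩
  σ ⊓ 0 ℕ.+ m ⊓ a               ≡⟨ cong (ℕ._+ m ⊓ a) (ℕₚ.⊓-zeroʳ σ) ⟩
  m ⊓ a                         ≡⟨ ℕₚ.m≥n⇒m⊓n≡n a≤m ⟩
  a                             ≡⟨ ℕₚ.m≥n⇒m⊓n≡n (ℕₚ.≤-trans a≤m (ℕₚ.m≤n+m m σ)) ⟨
  (σ ℕ.+ m) ⊓ a                 ∎
  where open ≡-Reasoning

-- The head is the piece with `t = k`. Since `suc k ∸ suc (suc (toℕ i))` reduces to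
-- `k ∸ suc (toℕ i)`, the tail is literally the sum for `k` with the same `a`.
sum-pieces : ∀ k σ a → sum {k} (λ i → piece σ a (k ∸ suc (toℕ i))) ≡ (k ℕ.* σ) ⊓ a
sum-pieces zero    σ a = refl
sum-pieces (suc k) σ a =
  trans (cong (piece σ a k ℕ.+_) (sum-pieces k σ a)) (⊓-∸-split σ a (k ℕ.* σ))

IsSaturating : ∀ {k} → ℕ → (Fin (suc k) → ℕ) → Set
IsSaturating σ f = ∀ i → f (inject₁ i) ≢ 0 → f (Fin.suc i) ≡ σ

-- As `σ` is positive, a term equal to `σ` is again nonzero and forces the next one.
saturating-tail : ∀ {k σ} .{{_ : NonZero σ}} (f : Fin (suc k) → ℕ) → IsSaturating σ f →
  f Fin.zero ≢ 0 → ∀ i → f (Fin.suc i) ≡ σ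
saturating-tail f sat f0≢0 Fin.zero = sat Fin.zero f0≢0
saturating-tail {σ = σ} f sat f0≢0 (Fin.suc i) =
  saturating-tail (f ∘ Fin.suc) (sat ∘ Fin.suc)
    (λ f1≡0 → ℕ.≢-nonZero⁻¹ σ (trans (sym (sat Fin.zero f0≢0)) f1≡0)) i

saturating-unique : ∀ {k σ} .{{_ : NonZero σ}} (f : Fin (suc k) → ℕ) → (∀ i → f i ℕ.≤ σ) →
  IsSaturating σ f → ∀ i → f i ≡ piece σ (sum f) (k ∸ toℕ i)
saturating-unique {k} {σ} f f≤σ sat i with f Fin.zero ℕₚ.≟ 0
saturating-unique {k} {σ} f f≤σ sat Fin.zero | yes f0≡0 = begin
  f Fin.zero             ≡⟨ f0≡0 ⟩
  0                      ≡⟨ ℕₚ.⊓-zeroʳ σ ⟨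
  σ ⊓ 0                  ≡⟨ cong (σ ⊓_) (ℕₚ.m≤n⇒m∸n≡0 sum≤kσ) ⟨
  piece σ (sum f) k      ∎
  where
  open ≡-Reasoning
  sum≤kσ : sum f ℕ.≤ k ℕ.* σ
  sum≤kσ = subst (λ x → x ℕ.+ sum (f ∘ Fin.suc) ℕ.≤ k ℕ.* σ) (sym f0≡0) (sum-≤ (f ∘ Fin.suc) (f≤σ ∘ Fin.suc))
-- Dropping a leading zero changes neither the sum nor the number of terms after position `i`.
saturating-unique {suc k} {σ} f f≤σ sat (Fin.suc i) | yes f0≡0 =
  trans (saturating-unique (f ∘ Fin.suc) (f≤σ ∘ Fin.suc) (sat ∘ Fin.suc) i)
        (cong (λ x → piece σ (x ℕ.+ sum (f ∘ Fin.suc)) (k ∸ toℕ i)) (sym f0≡0))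
saturating-unique {k} {σ} f f≤σ sat Fin.zero | no f0≢0 = begin
  f Fin.zero                               ≡⟨ ℕₚ.m≥n⇒m⊓n≡n (f≤σ Fin.zero) ⟨
  σ ⊓ f Fin.zero                           ≡⟨ cong (σ ⊓_) (ℕₚ.m+n∸n≡m (f Fin.zero) (k ℕ.* σ)) ⟨
  -- The `k` later terms all equal `σ`, so subtracting `k * σ` from the sum leaves the first term.
  piece σ (f Fin.zero ℕ.+ k ℕ.* σ) k       ≡⟨ cong (λ x → piece σ (f Fin.zero ℕ.+ x) k) (sum-const (f ∘ Fin.suc) (saturating-tail f sat f0≢0)) ⟨
  piece σ (sum f) k                        ∎
  where open ≡-Reasoning
-- The tail alone sums to `suc k * σ`, which already fills block `k ∸ toℕ i`.
saturating-unique {suc k} {σ} f f≤σ sat (Fin.suc i) | no f0≢0 =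
  trans (tail i) (sym (piece-full σ (k ∸ toℕ i) (begin
    suc (k ∸ toℕ i) ℕ.* σ         ≤⟨ ℕₚ.*-monoˡ-≤ σ (s≤s (ℕₚ.m∸n≤m k (toℕ i))) ⟩
    suc k ℕ.* σ                   ≡⟨ sum-const (f ∘ Fin.suc) tail ⟨
    sum (f ∘ Fin.suc)             ≤⟨ ℕₚ.m≤n+m _ (f Fin.zero) ⟩
    sum f                         ∎)))
  where
  open ℕₚ.≤-Reasoning
  tail = saturating-tail f sat f0≢0

-- Existence, uniqueness and extremality of the chain

theorem1 : ∀ {ℓ : Level} (n : ℕ) .{{_ : NonZero n}}
    (P : NaturallyLabeledPoset n ℓ)
    (s : Fin n → ℕ) .{{_ : ∀ {i} → NonZero (s i)}}
    (k-1 : ℕ) → let k = suc k-1 in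
    (v : Fin n → ℤ) → v ∈ latticePoints (dilate k (O s P)) →
    ∃[ w ] (IsChainDecomposition P s {k-1} v w
    × (∀ w′ → IsChainDecomposition P s {k-1} v w′ → ∀ i x → w′ i x ≡ w i x)
    × (∀ (m : ℕ) → m ℕ.≤ k → (γ : Fin m → Fin n → ℤ) →
    (∀ i → γ i ∈ latticePoints (O s P)) → IsSumOf v γ →
    ∀ x i → w Fin.zero x ℤ.≤ γ i x × γ i x ℤ.≤ w (Fin.fromℕ k-1) x))
theorem1 n P s k-1 v v∈kO = w , isDecomposition , unique , extremal
  where
  open NaturallyLabeledPoset P using (_≺_)

  -- Lattice points of the dilate are non-negative, so absolute values lose nothing and the argument
  -- moves to `ℕ`.
  a : Fin n → ℕ
  a x = ℤ.∣ v x ∣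

  v≡a : ∀ x → v x ≡ + a x
  v≡a x = sym (ℤₚ.0≤i⇒+∣i∣≡i (dilate-lower P s {suc k-1} {v} v∈kO x))

  a≤ks : ∀ x → a x ℕ.≤ suc k-1 ℕ.* s x
  a≤ks x = ℤₚ.drop‿+≤+ (subst (ℤ._≤ _) (v≡a x) (dilate-upper P s {suc k-1} {v} v∈kO x))

  a-mono : ∀ x y → x ≺ y → a x ℕ.* s y ℕ.≤ a y ℕ.* s x
  a-mono x y x≺y = ℤₚ.drop‿+≤+ (subst₂ ℤ._≤_ (eq x y) (eq y x) (dilate-mono P s {suc k-1} {v} v∈kO x y x≺y))
    where
    eq : ∀ x y → v x ℤ.* + s y ≡ + (a x ℕ.* s y)
    eq x y = trans (cong (ℤ._* + s y) (v≡a x)) (sym (ℤₚ.pos-* (a x) (s y)))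

  -- Among `k` terms, the one at position `i` is followed by `k-1 ∸ toℕ i` others.
  w : Fin (suc k-1) → Fin n → ℤ
  w i x = + piece (s x) (a x) (k-1 ∸ toℕ i)

  -- The same passage to `ℕ` for a family of lattice points, used for a rival chain in `unique` and
  -- for arbitrary summands in `extremal`.
  module _ {m} (γ : Fin m → Fin n → ℤ) (γ∈O : ∀ i → γ i ∈ latticePoints (O s P)) (x : Fin n) where

    γ≡∣γ∣ : ∀ i → γ i x ≡ + ℤ.∣ γ i x ∣
    γ≡∣γ∣ i = sym (ℤₚ.0≤i⇒+∣i∣≡i (proj₁ (latticePoint-bounds P s {γ i} (γ∈O i) x)))

    ∣γ∣≤s : ∀ i → ℤ.∣ γ i x ∣ ℕ.≤ s x
    ∣γ∣≤s i = ℤₚ.drop‿+≤+ (subst (ℤ._≤ _) (γ≡∣γ∣ i) (proj₂ (latticePoint-bounds P s {γ i} (γ∈O i) x)))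

    sum-∣γ∣ : IsSumOf v γ → a x ≡ sum (λ i → ℤ.∣ γ i x ∣)
    sum-∣γ∣ v≡Σγ = ℤₚ.+-injective (trans (sym (v≡a x)) (trans (v≡Σγ x) (sumℤ-+ _ _ γ≡∣γ∣)))

  isDecomposition : IsChainDecomposition P s v w
  isDecomposition = record
    { isLatticePoint = λ i → latticePoint⁺ P s _
        (λ x y x≺y → piece-mono (s x) (a x) (s y) (a y) (k-1 ∸ toℕ i) (a-mono x y x≺y))
        (λ x → ℕₚ.m⊓n≤m (s x) _)
    ; isChain = λ i → let t = k-1 ∸ suc (toℕ i) in
        (λ x → ℤ.+≤+ (subst (λ r → piece (s x) (a x) r ℕ.≤ piece (s x) (a x) t) (sym (index i))
          (piece-antitone (s x) (a x) t))) ,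
        (λ x w≢0 → cong +_ (piece-saturates (s x) (a x) t
          (subst (λ r → piece (s x) (a x) r ≢ 0) (index i) (w≢0 ∘ cong +_))))
    ; isSum = λ x → trans (v≡a x) (sym (trans
        (sumℤ-+ (λ i → w i x) (λ i → piece (s x) (a x) (k-1 ∸ toℕ i)) (λ _ → refl))
        (cong +_ (trans (sum-pieces (suc k-1) (s x) (a x)) (ℕₚ.m≥n⇒m⊓n≡n (a≤ks x))))))
    }
    where
    -- Position `inject₁ i` has one more successor than `Fin.suc i`; `toℕ i < k-1` keeps the
    -- subtraction from truncating.
    index : ∀ (i : Fin k-1) → k-1 ∸ toℕ (inject₁ i) ≡ suc (k-1 ∸ suc (toℕ i))
    index i = trans (cong (k-1 ∸_) (Finₚ.toℕ-inject₁ i)) (ℕₚ.+-∸-assoc 1 (Finₚ.toℕ<n i))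

  unique : ∀ w′ → IsChainDecomposition P s v w′ → ∀ i x → w′ i x ≡ w i x
  unique w′ dec i x = trans (w′≡∣w′∣ i) (cong +_ (trans
    (saturating-unique (λ j → ℤ.∣ w′ j x ∣) (∣γ∣≤s w′ isLatticePoint x) sat i)
    (cong (λ b → piece (s x) b (k-1 ∸ toℕ i)) (sym (sum-∣γ∣ w′ isLatticePoint x isSum)))))
    where
    open IsChainDecomposition dec
    w′≡∣w′∣ = γ≡∣γ∣ w′ isLatticePoint x

    sat : IsSaturating (s x) (λ j → ℤ.∣ w′ j x ∣)
    sat j ≢0 = cong ℤ.∣_∣ (proj₂ (isChain j) x (≢0 ∘ cong ℤ.∣_∣))

  extremal : ∀ m → m ℕ.≤ suc k-1 → (γ : Fin m → Fin n → ℤ) →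
    (∀ i → γ i ∈ latticePoints (O s P)) → IsSumOf v γ →
    ∀ x i → w Fin.zero x ℤ.≤ γ i x × γ i x ℤ.≤ w (Fin.fromℕ k-1) x
  -- An empty sum has no index `i`. With `suc m` summands, at most `k-1` stand beside the chosen
  -- one.
  extremal (suc m) (s≤s m≤k-1) γ γ∈O v≡Σγ x i =
    subst (w Fin.zero x ℤ.≤_) (sym (γ≡∣γ∣ γ γ∈O x i)) (ℤ.+≤+ lower) ,
    subst (ℤ._≤ w (Fin.fromℕ k-1) x) (sym (γ≡∣γ∣ γ γ∈O x i)) (ℤ.+≤+ upper)
    where
    open ℕₚ.≤-Reasoning
    f : Fin (suc m) → ℕ
    f j = ℤ.∣ γ j x ∣

    f≤s = ∣γ∣≤s γ γ∈O x
    a≡Σf = sum-∣γ∣ γ γ∈O x v≡Σγ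

    lower : piece (s x) (a x) k-1 ℕ.≤ f i
    lower = ℕₚ.≤-trans (ℕₚ.m⊓n≤n (s x) _) (ℕₚ.m≤n+o⇒m∸n≤o (a x) (k-1 ℕ.* s x) (begin
      a x                      ≡⟨ a≡Σf ⟩
      sum f                    ≤⟨ sum≤others+term f f≤s i ⟩
      m ℕ.* s x ℕ.+ f i        ≤⟨ ℕₚ.+-monoˡ-≤ (f i) (ℕₚ.*-monoˡ-≤ (s x) m≤k-1) ⟩
      k-1 ℕ.* s x ℕ.+ f i      ∎))

    upper : f i ℕ.≤ piece (s x) (a x) (k-1 ∸ toℕ (Fin.fromℕ k-1))
    -- The last position has `t = 0`, where `piece` reduces to `s x ⊓ a x`.
    upper = subst (λ t → f i ℕ.≤ piece (s x) (a x) t)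
      (sym (trans (cong (k-1 ∸_) (Finₚ.toℕ-fromℕ k-1)) (ℕₚ.n∸n≡0 k-1)))
      (ℕₚ.⊓-glb (f≤s i) (subst (f i ℕ.≤_) (sym a≡Σf) (term≤sum f i)))
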